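{- Let $\varphi$ be a satisfiable LTL formula over the variables in $\mathcal{I}\cup\mathcal{O}$. Then the algorithm $\mathcal{NDC}$ described in the context, run on input $\varphi$ (whatever the choices of variables made by the algorithm and whatever falsifying traces are returned by the validity checker), returns a partition of $\mathcal{O}$ into minimal independent sets; that is, the returned sets are pairwise disjoint with union $\mathcal{O}$, each is independent in $\varphi$, and none of them has a non-empty proper subset that is independent in $\varphi$.
   Context: Propositional variables are split into two disjoint sets: $\mathcal{I}$ (controlled by the environment) and the finite set $\mathcal{O}$ (controlled by the system). $\mathcal{O}'=\{y'\mid y\in\mathcal{O}\}$ is a set of fresh primed copies of the variables in $\mathcal{O}$. LTL formulae are built from variables with $\neg,\wedge$, $\bigcirc$ (next), $\mathcal{U}$ (until) and the usual abbreviations $\mathbf{F}$ (the constant false), $\vee,\to,\leftrightarrow$, $\Diamond$ (eventually), $\Box$ (always). They are interpreted with the standard semantics, evaluated at position $0$, over traces, i.e. infinite sequences $\sigma=\sigma_0,\sigma_1,\dots$ of sets of variables ($\sigma_i$ is the set of variables true at time $i$). A formula is valid if all traces (over the variables $\mathcal{I}\cup\mathcal{O}\cup\mathcal{O}'$) satisfy it. For $V\subseteq\mathcal{O}$ put $\overline V=\mathcal{O}\setminus V$. The projection formula $\varphi_V$ is obtained from $\varphi$ by replacing every variable $w\in\overline V$ by its primed copy $w'$ (variables in $\mathcal{I}\cup V$ are unchanged). Independence: $V\subseteq\mathcal{O}$ is independent in $\varphi$ iff the formula $(\varphi_V\wedge\varphi_{\overline V})\to\varphi$ is valid. CheckValidity$(\Phi)$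 returns $(\mathit{true},\cdot)$ if the LTL formula $\Phi$ is valid, and otherwise returns $(\mathit{false},\sigma)$, where $\sigma$ is some (arbitrary) trace over $\mathcal{I}\cup\mathcal{O}\cup\mathcal{O}'$ with $\sigma\not\models\Phi$. Algorithm $\mathcal{NDC}$ (input: a satisfiable LTL formula $\varphi$ over $\mathcal{I}\cup\mathcal{O}$; output: $\mathit{clusters}$): - Set $\mathit{clusters}:=\emptyset$, $R:=\mathcal{O}$. - Main loop: while $R\neq\emptyset$: choose any $x\in R$; set $V:=\{x\}$; repeat the following inner loop until $\mathit{passed}$ is true: [$\overline V:=\mathcal{O}\setminus V$; $(\mathit{passed},\sigma):=$ CheckValidity$((\varphi_V\wedge\varphi_{\overline V})\to\varphi)$; if not $\mathit{passed}$, then $D:=$ NewParseTrace$(\varphi,V,\sigma)$ and $V:=V\cup D$]. Then set $\mathit{clusters}:=\mathit{clusters}\cup\{V\}$ and $R:=\mathcal{O}\setminus\bigcup_{S\in\mathit{clusters}}S$. - Return $\mathit{clusters}$. NewParseTrace$(\varphi,V,\sigma)$, where $\sigma\models\varphi_V\wedge\varphi_{\overline V}\wedge\neg\varphi$: - Set $\mathit{passed}:=\mathit{false}$, $\mathit{binds}:=\mathbf{F}$, $\tau:=\sigma$. - While not $\mathit{passed}$: let $Z:=\{z\in\overline V : \text{for some } i\ge 0,\ (z\in\tau_i \text{ iff } z'\notin\tau_i)\}$; let $z$ be any variable in $Z$; set $\mathit{binds}:=\mathit{binds}\vee\Diamond(z\leftrightarrow\neg z')$; set $(\mathit{passed},\tau):=$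 CheckValidity$(\mathit{binds}\vee((\varphi_V\wedge\varphi_{\overline V})\to\varphi))$. - Return $\{z\}$ (the last variable chosen). -}

module Defs where

open import Data.Bool.Base using (Bool; true; false; T; if_then_else_)
open import Data.Empty using (⊥)
open import Data.Fin.Base using (Fin)
open import Data.Fin.Subset
  using (Subset; ⊤; ⁅_⁆; _∈_; _⊂_; _∩_; _∪_; ∁; ⋃; Nonempty; Empty)
open import Data.Fin.Subset.Properties using (_∈?_)
open import Data.List.Base using (List; []; _∷_)
open import Data.List.Relation.Unary.All using (All)
open import Data.List.Relation.Unary.AllPairs using (AllPairs)
open import Data.Nat.Base using (ℕ; suc; _≤_; _<_)
open import Data.Product.Base using (_×_; _,_; ∃; ∃-syntax)
open import Function.Base using (flip)
open import Function.Bundles using (_⇔_)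
open import Induction.WellFounded using (Acc)
open import Relation.Binary.Construct.Closure.ReflexiveTransitive using (Star)
open import Relation.Binary.PropositionalEquality.Core using (_≡_)
open import Relation.Binary.Rewriting using (IsNormalForm)
open import Relation.Nullary.Decidable.Core using (does)
open import Relation.Nullary.Negation.Core using (¬_)

infix  20 ~_ ○_
infixr 15 _U_
infixr 14 _∧_

data LTL (A : Set) : Set where
  var : A → LTL A
  𝐅   : LTL A
  ~_  : LTL A → LTL A
  _∧_ : LTL A → LTL A → LTL A
  ○_  : LTL A → LTL A
  _U_ : LTL A → LTL A → LTL A

module _ {A : Set} where

  infix  20 ◇_
  infixr 13 _∨_
  infixr 12 _⇒_
  infix  11 _↔_

  _∨_ _⇒_ _↔_ : LTL A → LTL A → LTL A
  a ∨ b = ~ (~ a ∧ ~ b)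
  a ⇒ b = ~ (a ∧ ~ b)
  a ↔ b = (a ⇒ b) ∧ (b ⇒ a)

  ◇_ : LTL A → LTL A
  ◇ a = ~ 𝐅 U a

rename : {A B : Set} → (A → B) → LTL A → LTL B
rename f (var a) = var (f a)
rename f 𝐅       = 𝐅
rename f (~ a)   = ~ rename f a
rename f (a ∧ b) = rename f a ∧ rename f b
rename f (○ a)   = ○ rename f a
rename f (a U b) = rename f a U rename f b

-- The set of variables true at each time, as a characteristic function.
Trace : Set → Set
Trace A = ℕ → A → Bool

module _ {A : Set} where

  infix 4 _,_⊨_ _⊨_ _⊭_ _∈[_]_ _∉[_]_

  _∈[_]_ _∉[_]_ : A → ℕ → Trace A → Set
  a ∈[ i ] σ = T (σ i a)
  a ∉[ i ] σ = ¬ (a ∈[ i ] σ)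

  _,_⊨_ : Trace A → ℕ → LTL A → Set
  σ , i ⊨ var a   = a ∈[ i ] σ
  σ , i ⊨ 𝐅       = ⊥
  σ , i ⊨ ~ a     = ¬ (σ , i ⊨ a)
  σ , i ⊨ (a ∧ b) = (σ , i ⊨ a) × (σ , i ⊨ b)
  σ , i ⊨ ○ a     = σ , suc i ⊨ a
  σ , i ⊨ (a U b) =
    ∃[ k ] i ≤ k × (σ , k ⊨ b) × (∀ j → i ≤ j → j < k → σ , j ⊨ a)

  _⊨_ _⊭_ : Trace A → LTL A → Set
  σ ⊨ φ = σ , 0 ⊨ φ
  σ ⊭ φ = ¬ (σ ⊨ φ)

  Satisfiable Valid : LTL A → Set
  Satisfiable φ = ∃[ σ ] σ ⊨ φ
  Valid       φ = ∀ σ → σ ⊨ φ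

  -- The possible answers of the validity checker; the trace accompanying a
  -- positive answer is irrelevant and left arbitrary.
  data CheckValidity (φ : LTL A) : Bool × Trace A → Set where
    valid   : ∀ {σ} → Valid φ → CheckValidity φ (true  , σ)
    invalid : ∀ {σ} → σ ⊭ φ   → CheckValidity φ (false , σ)

-- I ∪ O, where O = Fin n.
data Var (I : Set) (n : ℕ) : Set where
  input  : I → Var I n
  output : Fin n → Var I n

-- I ∪ O ∪ O′.
data Var′ (I : Set) (n : ℕ) : Set where
  plain  : Var I n → Var′ I n
  primed : Fin n → Var′ I n

module _ {I : Set} {n : ℕ} where

  out out′ : Fin n → Var′ I n
  out  w = plain (output w)
  out′ w = primed w

  project : Subset n → Var I n → Var′ I n
  project V (input x)  = plain (input x)
  project V (output w) = if does (w ∈? V) then out w else out′ w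

  projection : LTL (Var I n) → Subset n → LTL (Var′ I n)
  projection φ V = rename (project V) φ

  independence : LTL (Var I n) → Subset n → LTL (Var′ I n)
  independence φ V = (projection φ V ∧ projection φ (∁ V)) ⇒ rename plain φ

  Independent : LTL (Var I n) → Subset n → Set
  Independent φ V = Valid (independence φ V)

  MinimalIndependent : LTL (Var I n) → Subset n → Set
  MinimalIndependent φ V =
    Independent φ V × (∀ W → Nonempty W → W ⊂ V → ¬ Independent φ W)

  -- The set Z of NewParseTrace.
  Z : Subset n → Trace (Var′ I n) → Fin n → Set
  Z V τ z = z ∈ ∁ V × ∃[ i ] (out z ∈[ i ] τ ⇔ out′ z ∉[ i ] τ)

-- Disjointness is by position, so in particular no block is repeated.
IsPartition : {n : ℕ} → List (Subset n) → Set
IsPartition C =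
  All Nonempty C × AllPairs (λ V W → Empty (V ∩ W)) C × ⋃ C ≡ ⊤

-- Control points of NDC together with the live program variables. The set of
-- clusters is kept as a list, newest cluster first.
data State (I : Set) (n : ℕ) : Set where
  mainLoop  : (clusters : List (Subset n)) (R : Subset n) → State I n
  innerLoop : (clusters : List (Subset n)) (V : Subset n) → State I n
  parseLoop : (clusters : List (Subset n)) (V : Subset n)
              (binds : LTL (Var′ I n)) (τ : Trace (Var′ I n)) → State I n
  return    : (clusters : List (Subset n)) → State I n

module NDC {I : Set} {n : ℕ} (φ : LTL (Var I n)) where

  start : State I n
  start = mainLoop [] ⊤

  bind : LTL (Var′ I n) → Fin n → LTL (Var′ I n)
  bind binds z = binds ∨ ◇ (var (out z) ↔ ~ var (out′ z))

  infix 4 _⟶_ _—↠_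

  -- Every choice of a variable and every answer of the validity checker is a
  -- separate transition; different calls need not give the same answer.
  data _⟶_ : State I n → State I n → Set where

    choose : ∀ {C R x} → x ∈ R →
      mainLoop C R ⟶ innerLoop C ⁅ x ⁆

    finish : ∀ {C R} → Empty R →
      mainLoop C R ⟶ return C

    passed : ∀ {C V σ} →
      CheckValidity (independence φ V) (true , σ) →
      innerLoop C V ⟶ mainLoop (V ∷ C) (∁ (⋃ (V ∷ C)))

    failed : ∀ {C V σ} →
      CheckValidity (independence φ V) (false , σ) →
      innerLoop C V ⟶ parseLoop C V 𝐅 σ

    parsePassed : ∀ {C V binds τ z τ′} → Z V τ z →
      CheckValidity (bind binds z ∨ independence φ V) (true , τ′) →
      parseLoop C V binds τ ⟶ innerLoop C (V ∪ ⁅ z ⁆)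

    parseFailed : ∀ {C V binds τ z τ′} → Z V τ z →
      CheckValidity (bind binds z ∨ independence φ V) (false , τ′) →
      parseLoop C V binds τ ⟶ parseLoop C V (bind binds z) τ′

  _—↠_ : State I n → State I n → Set
  _—↠_ = Star _⟶_

  -- There is no infinite run.
  Terminates : Set
  Terminates = Acc (flip _⟶_) start

  -- Every run that cannot be continued has returned some C with P C; being
  -- unable to continue anywhere else is thereby excluded. Returning states have
  -- no successors, so this covers every returned C.
  Returns : (List (Subset n) → Set) → Set
  Returns P =
    ∀ s → start —↠ s → IsNormalForm _⟶_ s → ∃[ C ] s ≡ return C × P C

{-# OPTIONS --safe #-}

-- Semantically, W is independent iff any two solutions of φ that share their
-- inputs can be exchanged on W: one of them restricted to W, combined with the
-- other one outside W, is again a solution. Hence independence passes to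
-- complements, and it suffices that the set V grown from x stays inside every
-- independent W containing x.
--
-- Suppose z ∉ W is returned by NewParseTrace from the trace τ. Overwrite the
-- primed copies outside W by the unprimed values. By exchange, the new trace
-- still refutes the independence of V; its variables differing from their
-- primed copies are among those of τ, and z is no longer one of them, so
-- neither z nor any earlier bind holds. This contradicts the validity check
-- that ended the loop.
module Submission where

open import Defs
open import Data.Bool.Base using (true; false; T; if_then_else_)
import Data.Bool.Properties as Bool
open import Data.Empty using (⊥-elim)
open import Data.Fin.Base using (Fin)
open import Data.Fin.Subset
  using (Subset; ⊤; ⊥; ⁅_⁆; _∈_; _∉_; _⊆_; _⊂_; _⊃_; _∩_; _∪_; ∁; ⋃; Nonempty; Empty)
open import Data.Fin.Subset.Induction using (⊃-wellFounded)
open import Data.Fin.Subset.Properties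
open import Data.List.Base using (List; []; _∷_)
open import Data.List.Membership.Propositional using () renaming (_∈_ to _∈ₗ_)
open import Data.List.Relation.Unary.All as All using (All; []; _∷_)
open import Data.List.Relation.Unary.AllPairs using (AllPairs; []; _∷_)
open import Data.List.Relation.Unary.Any using (here; there)
open import Data.Nat.Base using (ℕ; z≤n)
open import Data.Product.Base using (_×_; _,_; proj₁; ∃-syntax)
open import Data.Sum.Base using ([_,_]′)
open import Data.Unit.Base using (tt)
open import Function.Base using (_∘_; flip; id)
open import Function.Bundles using (_⇔_; mk⇔; module Equivalence)
open import Induction.WellFounded using (Acc; acc)
open import Relation.Binary.Construct.Closure.ReflexiveTransitive using (ε; _◅_)
open import Relation.Binary.PropositionalEquality
  using (_≡_; refl; sym; trans; cong; subst)
open import Relation.Binary.Rewriting using (IsNormalForm)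
open import Relation.Nullary using (¬_; yes; no; does; contradiction)
open import Relation.Nullary.Decidable using (dec-true; dec-false; decidable-stable)

open Equivalence using (to; from)

-- Semantics of renaming and disjunction, and answers of the checker.

⊨-rename : {A B : Set} (f : A → B) {σ : Trace B} {ρ : Trace A} →
           (∀ i a → σ i (f a) ≡ ρ i a) →
           ∀ φ {i} → (σ , i ⊨ rename f φ) ⇔ (ρ , i ⊨ φ)
⊨-rename f eq (var a) {i} = mk⇔ (subst T (eq i a)) (subst T (sym (eq i a)))
⊨-rename f eq 𝐅 = mk⇔ id id
⊨-rename f eq (~ a) = mk⇔ (_∘ from (⊨-rename f eq a)) (_∘ to (⊨-rename f eq a))
⊨-rename f eq (a ∧ b) = mk⇔
  (λ (p , q) → to (⊨-rename f eq a) p , to (⊨-rename f eq b) q)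
  (λ (p , q) → from (⊨-rename f eq a) p , from (⊨-rename f eq b) q)
⊨-rename f eq (○ a) = ⊨-rename f eq a
⊨-rename f eq (a U b) = mk⇔
  (λ (k , i≤k , p , q) →
     k , i≤k , to (⊨-rename f eq b) p , λ j i≤j j<k → to (⊨-rename f eq a) (q j i≤j j<k))
  (λ (k , i≤k , p , q) →
     k , i≤k , from (⊨-rename f eq b) p , λ j i≤j j<k → from (⊨-rename f eq a) (q j i≤j j<k))

⊭-∨ : {A : Set} {σ : Trace A} (a b : LTL A) → (σ ⊭ (a ∨ b)) ⇔ (σ ⊭ a × σ ⊭ b)
⊭-∨ a b = mk⇔
  (λ ¬¬ab → (λ p → ¬¬ab λ (¬a , _) → ¬a p) , (λ p → ¬¬ab λ (_ , ¬b) → ¬b p))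
  (λ ¬ab ¬¬ab → ¬¬ab ¬ab)

-- Stated for negations, whose truth is stable; implications and disjunctions
-- are negations by definition.
checker-answers : {A : Set} (a : LTL A) → ¬ ¬ (∃[ r ] CheckValidity (~ a) r)
checker-answers a ¬r =
  ¬r (_ , valid {σ = λ _ _ → true} λ σ p → ¬r (_ , invalid {σ = σ} λ ¬p → ¬p p))

T⇔¬T⇒≢ : ∀ {x y} → T x ⇔ (¬ T y) → ¬ (x ≡ y)
T⇔¬T⇒≢ {true}  e refl = to e tt tt
T⇔¬T⇒≢ {false} e refl = from e id

≢⇒T⇔¬T : ∀ {x y} → ¬ (x ≡ y) → T x ⇔ (¬ T y)
≢⇒T⇔¬T {true}  {true}  x≢y = contradiction refl x≢y
≢⇒T⇔¬T {true}  {false} _   = mk⇔ (λ _ ()) (λ _ → tt)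
≢⇒T⇔¬T {false} {true}  _   = mk⇔ (λ ()) (λ ¬y → ¬y tt)
≢⇒T⇔¬T {false} {false} x≢y = contradiction refl x≢y

-- Finite subsets.

module _ {n : ℕ} where

  ∁-involutive : (p : Subset n) → ∁ (∁ p) ≡ p
  ∁-involutive p = ⊆-antisym
    (x∉∁p⇒x∈p ∘ x∈∁p⇒x∉p) (x∉p⇒x∈∁p ∘ x∈p⇒x∉∁p)

  ∁⊥≡⊤ : ∁ ⊥ ≡ ⊤ {n}
  ∁⊥≡⊤ = trans (sym (∪-identityˡ (∁ ⊥))) (p∪∁p≡⊤ ⊥)

  p⊂p∪⁅x⁆ : ∀ {p : Subset n} {x} → x ∉ p → p ⊂ p ∪ ⁅ x ⁆
  p⊂p∪⁅x⁆ {p} {x} x∉p = p⊆p∪q ⁅ x ⁆ , x , q⊆p∪q p ⁅ x ⁆ (x∈⁅x⁆ x) , x∉p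

  p∪⁅x⁆⊆q : ∀ {p q : Subset n} {x} → p ⊆ q → x ∈ q → p ∪ ⁅ x ⁆ ⊆ q
  p∪⁅x⁆⊆q {p} {q} {x} p⊆q x∈q y∈ =
    [ p⊆q , (λ y∈⁅x⁆ → subst (_∈ q) (sym (x∈⁅y⁆⇒x≡y x y∈⁅x⁆)) x∈q) ]′ (x∈p∪q⁻ p ⁅ x ⁆ y∈)

  p∈ps⇒p⊆⋃ps : ∀ {p : Subset n} {ps} → p ∈ₗ ps → p ⊆ ⋃ ps
  p∈ps⇒p⊆⋃ps {ps = q ∷ ps} (here refl) = p⊆p∪q (⋃ ps)
  p∈ps⇒p⊆⋃ps {ps = q ∷ ps} (there p∈)  = q⊆p∪q q (⋃ ps) ∘ p∈ps⇒p⊆⋃ps p∈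

  if-∈ : {A : Set} {a b : A} {p : Subset n} {x : Fin n} → x ∈ p →
         (if does (x ∈? p) then a else b) ≡ a
  if-∈ {a = a} {b} {p} {x} x∈p = cong (if_then a else b) (dec-true (x ∈? p) x∈p)

  if-∉ : {A : Set} {a b : A} {p : Subset n} {x : Fin n} → x ∉ p →
         (if does (x ∈? p) then a else b) ≡ b
  if-∉ {a = a} {b} {p} {x} x∉p = cong (if_then a else b) (dec-false (x ∈? p) x∉p)

-- Traces with primed and unprimed outputs.

module _ {I : Set} {n : ℕ} where

  Agree : Trace (Var′ I n) → Fin n → Set
  Agree σ w = ∀ i → σ i (out w) ≡ σ i (out′ w)

  unprimed : Trace (Var′ I n) → Trace (Var I n)
  unprimed σ i v = σ i (plain v)

  mix : Subset n → Trace (Var′ I n) → Trace (Var I n)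
  mix V σ i v = σ i (project V v)

  -- The inputs come from the first trace; `merge W ρ ρ′` is used only where both traces have the
  -- same inputs.
  merge : Subset n → Trace (Var I n) → Trace (Var I n) → Trace (Var I n)
  merge W ρ ρ′ i (input x)  = ρ i (input x)
  merge W ρ ρ′ i (output w) =
    if does (w ∈? W) then ρ i (output w) else ρ′ i (output w)

  infix 4 _≗_
  _≗_ : Trace (Var I n) → Trace (Var I n) → Set
  ρ ≗ ρ′ = ∀ i v → ρ i v ≡ ρ′ i v

  mix-∈ : ∀ {V w} (σ : Trace (Var′ I n)) i → w ∈ V → mix V σ i (output w) ≡ σ i (out w)
  mix-∈ σ i w∈V = cong (σ i) (if-∈ w∈V)

  mix-∉ : ∀ {V w} (σ : Trace (Var′ I n)) i → w ∉ V → mix V σ i (output w) ≡ σ i (out′ w)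
  mix-∉ σ i w∉V = cong (σ i) (if-∉ w∉V)

  mix-∁-∈ : ∀ {V w} (σ : Trace (Var′ I n)) i → w ∈ V → mix (∁ V) σ i (output w) ≡ σ i (out′ w)
  mix-∁-∈ σ i w∈V = mix-∉ σ i (x∈p⇒x∉∁p w∈V)

  mix-∁-∉ : ∀ {V w} (σ : Trace (Var′ I n)) i → w ∉ V → mix (∁ V) σ i (output w) ≡ σ i (out w)
  mix-∁-∉ σ i w∉V = mix-∈ σ i (x∉p⇒x∈∁p w∉V)

  mix-agree : ∀ {V} (σ : Trace (Var′ I n)) → (∀ {w} → w ∉ V → Agree σ w) → mix V σ ≗ unprimed σ
  mix-agree σ agree i (input x) = refl
  mix-agree {V} σ agree i (output w) with w ∈? V
  ... | yes w∈V = refl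
  ... | no  w∉V = sym (agree w∉V i)

  differ : Fin n → LTL (Var′ I n)
  differ z = ◇ (var (out z) ↔ ~ var (out′ z))

  ⊭-differ : ∀ σ z → (σ ⊭ differ z) ⇔ Agree σ z
  ⊭-differ σ z = mk⇔ agree λ eq (k , _ , (p , q) , _) → disagree (eq k) p q
    where
    disagree : ∀ {x y} → x ≡ y → ¬ (T x × ¬ ¬ T y) → ¬ ¬ (¬ T y × ¬ T x)
    disagree {true}  refl p q = p (tt , λ ¬t → ¬t tt)
    disagree {false} refl p q = q (id , id)

    agree : σ ⊭ differ z → Agree σ z
    -- Boolean equality is stable, so a difference may be assumed; it makes the `◇` true with
    -- witness `i`.
    agree ¬d i = decidable-stable (σ i (out z) Bool.≟ σ i (out′ z)) λ x≢y →
      let e = ≢⇒T⇔¬T x≢y in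
      ¬d (i , z≤n , ((λ (x , ¬¬y) → ¬¬y (to e x)) , λ (¬y , ¬x) → ¬x (from e ¬y)) , λ _ _ _ → id)

  reset : Subset n → Trace (Var′ I n) → Trace (Var′ I n)
  reset W τ i (plain v)  = τ i (plain v)
  reset W τ i (primed w) = if does (w ∈? W) then τ i (out′ w) else τ i (out w)

  reset-agree : ∀ {W} τ {w} → Agree τ w → Agree (reset W τ) w
  reset-agree {W} τ {w} agree i with w ∈? W
  ... | yes _ = agree i
  ... | no  _ = refl

  reset-agree-∉ : ∀ {W} τ {w} → w ∉ W → Agree (reset W τ) w
  reset-agree-∉ τ w∉W i = sym (if-∉ w∉W)

  module _ {V W : Subset n} (V⊆W : V ⊆ W) (τ : Trace (Var′ I n)) where

    -- Inside `W` the primed copies survive. Outside `W` the overwritten copy is the unprimed value,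
    -- which is what `mix (∁ V)` reads there because `V ⊆ W`.
    mix-reset : mix V (reset W τ) ≗ merge W (mix V τ) (mix (∁ V) τ)
    mix-reset i (input x) = refl
    mix-reset i (output w) with w ∈? V | w ∈? W
    ... | yes w∈V | yes w∈W = refl
    ... | yes w∈V | no  w∉W = contradiction (V⊆W w∈V) w∉W
    ... | no  w∉V | yes w∈W = if-∈ w∈W
    ... | no  w∉V | no  w∉W = trans (if-∉ w∉W) (sym (mix-∁-∉ τ i w∉V))

    -- `mix (∁ V)` reads primed copies only inside `V`, where `reset W` changes nothing.
    mix-∁-reset : mix (∁ V) (reset W τ) ≗ mix (∁ V) τ
    mix-∁-reset i (input x) = refl
    mix-∁-reset i (output w) with w ∈? ∁ V
    ... | yes _   = refl
    ... | no  w∉∁V = if-∈ (V⊆W (x∉∁p⇒x∈p w∉∁V))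

-- Independence as exchange of solutions.

module _ {I : Set} {n : ℕ} (φ : LTL (Var I n)) where

  open NDC φ

  ⊨-resp : ∀ {σ : Trace (Var′ I n)} {f g} → (∀ i v → σ i (f v) ≡ σ i (g v)) →
           σ ⊨ rename f φ → σ ⊨ rename g φ
  ⊨-resp {f = f} {g} eq = from (⊨-rename g (λ i v → sym (eq i v)) φ) ∘ to (⊨-rename f (λ _ _ → refl) φ)

  -- The two projections merely trade places, up to a double complement.
  independent-∁ : ∀ {W} → Independent φ W → Independent φ (∁ W)
  independent-∁ {W} ind σ ((p , q) , ¬r) =
    ind σ ((subst (λ U → σ ⊨ projection φ U) (∁-involutive W) q , p) , ¬r)

  -- The double negation comes from `_⇒_`, which is a negated conjunction.
  exchange : ∀ {W ρ ρ′} → Independent φ W → (∀ i x → ρ i (input x) ≡ ρ′ i (input x)) →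
             ρ ⊨ φ → ρ′ ⊨ φ → ¬ ¬ (merge W ρ ρ′ ⊨ φ)
  exchange {W} {ρ} {ρ′} ind inputs p q ¬r =
    ind υ ( ( from (⊨-rename (project W) on-W φ) p
            , from (⊨-rename (project (∁ W)) on-∁W φ) q)
          , ¬r ∘ to (⊨-rename plain (λ _ _ → refl) φ))
    where
    -- The primed copies carry the complementary merge, so that projecting to `W` reads off `ρ` and
    -- projecting to `∁ W` reads off `ρ′`.
    υ : Trace (Var′ I n)
    υ i (plain v)  = merge W ρ ρ′ i v
    υ i (primed w) = merge W ρ′ ρ i (output w)

    on-W : mix W υ ≗ ρ
    on-W i (input x) = refl
    on-W i (output w) with w ∈? W
    ... | yes w∈W = if-∈ w∈W
    ... | no  w∉W = if-∉ w∉W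

    on-∁W : mix (∁ W) υ ≗ ρ′
    on-∁W i (input x) = inputs i x
    on-∁W i (output w) with w ∈? W
    ... | yes w∈W = trans (mix-∁-∈ υ i w∈W) (if-∈ w∈W)
    ... | no  w∉W = trans (mix-∁-∉ υ i w∉W) (if-∉ w∉W)

  -- Merging the two projections of `τ` along `W` gives the `V`-projection of `reset W τ`; its other
  -- projection and its unprimed values are those of `τ`.
  reset-counterexample : ∀ {V W τ} → V ⊆ W → Independent φ W →
                         τ ⊭ independence φ V → reset W τ ⊭ independence φ V
  reset-counterexample {V} {W} {τ} V⊆W ind cex holds = cex λ ((p , q) , ¬r) →
    exchange ind (λ _ _ → refl)
      (to (⊨-rename (project V) (λ _ _ → refl) φ) p)
      (to (⊨-rename (project (∁ V)) (λ _ _ → refl) φ) q)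
      λ m → holds
        ( ( from (⊨-rename (project V) (mix-reset V⊆W τ) φ) m
          , from (⊨-rename (project (∁ V)) (mix-∁-reset V⊆W τ) φ)
              (to (⊨-rename (project (∁ V)) (λ _ _ → refl) φ) q))
        , ¬r ∘ from (⊨-rename plain (λ _ _ → refl) φ) ∘ to (⊨-rename plain (λ _ _ → refl) φ))

  -- Variables collected by the parse loop.

  data Binds : LTL (Var′ I n) → Subset n → Set where
    []  : Binds 𝐅 ⊥
    _∷_ : ∀ {b B} z → Binds b B → Binds (bind b z) (B ∪ ⁅ z ⁆)

  ⊭-binds : ∀ {b B σ} → Binds b B → (σ ⊭ b) ⇔ (∀ z → z ∈ B → Agree σ z)
  ⊭-binds [] = mk⇔ (λ _ _ z∈⊥ → contradiction z∈⊥ ∉⊥) (λ _ → id)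
  ⊭-binds {σ = σ} (_∷_ {b} {B} z bs) = mk⇔
    (λ ¬bz → let ¬b , ¬d = to (⊭-∨ b (differ z)) ¬bz in
       λ y y∈ → [ to (⊭-binds bs) ¬b y
                , (λ y∈⁅z⁆ → subst (Agree σ) (sym (x∈⁅y⁆⇒x≡y z y∈⁅z⁆)) (to (⊭-differ σ z) ¬d))
                ]′ (x∈p∪q⁻ B ⁅ z ⁆ y∈))
    (λ agree → from (⊭-∨ b (differ z))
       ( from (⊭-binds bs) (λ y → agree y ∘ p⊆p∪q ⁅ z ⁆)
       , from (⊭-differ σ z) (agree z (q⊆p∪q B ⁅ z ⁆ (x∈⁅x⁆ z)))))

  -- Refuting `b` forces agreement on `B`, while `Z` exhibits a disagreement. So each chosen
  -- variable is new, which bounds the parse loop.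
  Z⇒∉binds : ∀ {V b B τ z} → Binds b B → τ ⊭ b → Z V τ z → z ∉ B
  Z⇒∉binds bs ¬b (_ , i , e) z∈B = T⇔¬T⇒≢ e (to (⊭-binds bs) ¬b _ z∈B i)

  -- Were `Z` empty, every output outside `V` would agree with its primed copy, and the
  -- `V`-projection would already give `φ`. A search through all positions yields no constructive
  -- witness, hence the double negation.
  Z-inhabited : ∀ {V τ} → τ ⊭ independence φ V → ¬ ¬ (∃[ z ] Z V τ z)
  Z-inhabited {V} {τ} cex ¬Z = cex λ ((p , _) , ¬r) → ¬r (⊨-resp {σ = τ} (mix-agree τ agree) p)
    where
    agree : ∀ {w} → w ∉ V → Agree τ w
    agree {w} w∉V i = decidable-stable (τ i (out w) Bool.≟ τ i (out′ w)) λ x≢y →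
      ¬Z (w , x∉p⇒x∈∁p w∉V , i , ≢⇒T⇔¬T x≢y)

  parsed-∈ : ∀ {V W b B τ z} → V ⊆ W → Independent φ W → Binds b B →
        τ ⊭ b → τ ⊭ independence φ V → Valid (bind b z ∨ independence φ V) → z ∈ W
  parsed-∈ {V} {W} {b} {τ = τ} {z} V⊆W ind bs ¬b cex v =
    decidable-stable (z ∈? W) λ z∉W →
      from (⊭-∨ (bind b z) (independence φ V))
        ( from (⊭-∨ b (differ z))
            ( from (⊭-binds bs) (λ y y∈B → reset-agree τ (to (⊭-binds bs) ¬b y y∈B))
            , from (⊭-differ (reset W τ) z) (reset-agree-∉ τ z∉W))
        , reset-counterexample V⊆W ind cex)
        (v (reset W τ))

  -- Termination.

  ⟵-Acc : State I n → Set
  ⟵-Acc = Acc (flip _⟶_)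

  -- The innermost of three nested inductions on growing subsets: a failed check enlarges `B`, a
  -- passed one enlarges `V` and falls back on `inner`.
  acc-parse : ∀ {C V b B τ} → Binds b B → τ ⊭ b → Acc _⊃_ B →
              (∀ {W} → V ⊂ W → ⟵-Acc (innerLoop C W)) → ⟵-Acc (parseLoop C V b τ)
  acc-parse {V = V} {b} bs ¬b (acc rs) inner = acc λ where
    (parsePassed (z∈∁V , _) _) → inner (p⊂p∪⁅x⁆ (x∈∁p⇒x∉p z∈∁V))
    (parseFailed {z = z} z∈Z (invalid ¬p)) →
      acc-parse (z ∷ bs) (proj₁ (to (⊭-∨ (bind b z) (independence φ V)) ¬p))
        (rs (p⊂p∪⁅x⁆ (Z⇒∉binds bs ¬b z∈Z))) inner

  -- The seed `x` lies in `V` but in no earlier cluster, so closing `V` strictly enlarges the union.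
  acc-inner : ∀ {C V x} → x ∉ ⋃ C → x ∈ V → Acc _⊃_ V →
              (∀ {C′} → ⋃ C ⊂ ⋃ C′ → ⟵-Acc (mainLoop C′ (∁ (⋃ C′)))) →
              ⟵-Acc (innerLoop C V)
  acc-inner {C} {V} {x} x∉C x∈V (acc rs) main = acc λ where
    (passed _) → main (q⊆p∪q V (⋃ C) , x , p⊆p∪q (⋃ C) x∈V , x∉C)
    (failed _) → acc-parse [] id (⊃-wellFounded ⊥)
      λ V⊂W → acc-inner x∉C (proj₁ V⊂W x∈V) (rs V⊂W) main

  acc-main : ∀ {C} → Acc _⊃_ (⋃ C) → ⟵-Acc (mainLoop C (∁ (⋃ C)))
  acc-main (acc rs) = acc λ where
    (choose {x = x} x∈R) →
      acc-inner (x∈∁p⇒x∉p x∈R) (x∈⁅x⁆ x) (⊃-wellFounded ⁅ x ⁆) λ C⊂C′ → acc-main (rs C⊂C′)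
    (finish _) → acc λ ()

  terminates : Terminates
  terminates = subst (λ R → ⟵-Acc (mainLoop [] R)) ∁⊥≡⊤ (acc-main (⊃-wellFounded ⊥))

  -- Minimality and disjointness of clusters.

  Clusters : List (Subset n) → Set
  Clusters C =
    All Nonempty C × AllPairs (λ V W → Empty (V ∩ W)) C × All (MinimalIndependent φ) C

  -- Inner loop invariant: once `V` is itself independent, it is the least independent set around
  -- the seed `x`.
  Core : Fin n → Subset n → Set
  Core x V = x ∈ V × (∀ W → Independent φ W → x ∈ W → V ⊆ W)

  core-minimal : ∀ {x V} → Core x V → Independent φ V → MinimalIndependent φ V
  core-minimal {x} {V} (x∈V , least) ind = ind , minimal
    where
    minimal : ∀ W → Nonempty W → W ⊂ V → ¬ Independent φ W
    minimal W (y , y∈W) (W⊆V , v , v∈V , v∉W) indW with x ∈? W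
    ... | yes x∈W = v∉W (least W indW x∈W v∈V)
    -- Now `∁ W` is an independent set around `x`, so it contains `V` and with it `y ∈ W`.
    ... | no  x∉W =
      x∈∁p⇒x∉p (least (∁ W) (independent-∁ indW) (x∉p⇒x∈∁p x∉W) (W⊆V y∈W)) y∈W

  -- For an earlier cluster `S`, the independent set `∁ S` contains the seed, so leastness puts `V`
  -- inside it.
  add-cluster : ∀ {C x V} → Clusters C → x ∉ ⋃ C → Core x V → Independent φ V → Clusters (V ∷ C)
  add-cluster {C} {x} {V} (ne , dis , min) x∉C core@(x∈V , least) ind =
    (x , x∈V) ∷ ne , All.tabulate disjoint ∷ dis , core-minimal core ind ∷ min
    where
    disjoint : ∀ {S} → S ∈ₗ C → Empty (V ∩ S)
    disjoint {S} S∈C (y , y∈V∩S) with x∈p∩q⁻ V S y∈V∩S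
    ... | y∈V , y∈S = x∈∁p⇒x∉p
      (least (∁ S) (independent-∁ (proj₁ (All.lookup min S∈C)))
        (x∉p⇒x∈∁p (x∉C ∘ p∈ps⇒p⊆⋃ps S∈C)) y∈V)
      y∈S

  -- Invariants along a run.

  data Invariant : State I n → Set where
    mainLoop  : ∀ {C R} → Clusters C → R ≡ ∁ (⋃ C) → Invariant (mainLoop C R)
    -- The seed `x` is not stored in the state and is recovered here.
    innerLoop : ∀ {C V x} → Clusters C → x ∉ ⋃ C → Core x V → Invariant (innerLoop C V)
    parseLoop : ∀ {C V x b B τ} → Clusters C → x ∉ ⋃ C → Core x V →
                Binds b B → τ ⊭ b → τ ⊭ independence φ V → Invariant (parseLoop C V b τ)
    return    : ∀ {C} → Clusters C → ⋃ C ≡ ⊤ → Invariant (return C)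

  preserved : ∀ {s t} → s ⟶ t → Invariant s → Invariant t
  preserved (choose {x = x} x∈R) (mainLoop cl refl) =
    innerLoop cl (x∈∁p⇒x∉p x∈R)
      (x∈⁅x⁆ x , λ W _ x∈W y∈ → subst (_∈ W) (sym (x∈⁅y⁆⇒x≡y x y∈)) x∈W)
  preserved (finish empty) (mainLoop cl refl) =
    return cl (⊆-antisym ⊆⊤ λ {y} _ → x∉∁p⇒x∈p λ y∈ → empty (y , y∈))
  preserved (passed (valid ind)) (innerLoop cl x∉C core) =
    mainLoop (add-cluster cl x∉C core ind) refl
  preserved (failed (invalid cex)) (innerLoop cl x∉C core) =
    -- `binds` starts as `𝐅`, which `id` refutes on any trace.
    parseLoop cl x∉C core [] id cex
  preserved (parsePassed {z = z} _ (valid v)) (parseLoop cl x∉C (x∈V , least) bs ¬b cex) =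
    innerLoop cl x∉C
      ( p⊆p∪q ⁅ z ⁆ x∈V
      , λ W ind x∈W → p∪⁅x⁆⊆q (least W ind x∈W) (parsed-∈ (least W ind x∈W) ind bs ¬b cex v))
  preserved (parseFailed {V = V} {b} {z = z} _ (invalid ¬p)) (parseLoop cl x∉C core bs ¬b cex) =
    let ¬b′ , cex′ = to (⊭-∨ (bind b z) (independence φ V)) ¬p in
    parseLoop cl x∉C core (z ∷ bs) ¬b′ cex′

  invariant : ∀ {s t} → s —↠ t → Invariant s → Invariant t
  invariant ε        inv = inv
  invariant (x ◅ xs) inv = invariant xs (preserved x inv)

  -- In the inner and parse loops a next step exists only under double negation, as validity is not
  -- decided constructively. This suffices, because there the goal is to refute being stuck.
  normalForm-returned : ∀ {s} → Invariant s → IsNormalForm _⟶_ s →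
                        ∃[ C ] s ≡ return C × IsPartition C × All (MinimalIndependent φ) C
  normalForm-returned (mainLoop {R = R} _ _) nf with nonempty? R
  ... | yes (_ , x∈R) = contradiction (_ , choose x∈R) nf
  ... | no  empty     = contradiction (_ , finish empty) nf
  normalForm-returned (innerLoop {V = V} _ _ _) nf = ⊥-elim (checker-answers
    ((projection φ V ∧ projection φ (∁ V)) ∧ ~ rename plain φ) λ where
    (_ , valid {σ} v)   → nf (_ , passed (valid {σ = σ} v))
    (_ , invalid {σ} v) → nf (_ , failed (invalid {σ = σ} v)))
  normalForm-returned (parseLoop {V = V} {b = b} _ _ _ _ _ cex) nf =
    ⊥-elim (Z-inhabited cex λ (z , z∈Z) → checker-answers
      (~ bind b z ∧ ~ independence φ V) λ where
      (_ , valid {σ} v)   → nf (_ , parsePassed z∈Z (valid {σ = σ} v))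
      (_ , invalid {σ} v) → nf (_ , parseFailed z∈Z (invalid {σ = σ} v)))
  normalForm-returned (return (ne , dis , min) ⋃≡⊤) _ = _ , refl , (ne , dis , ⋃≡⊤) , min

corollary2 : {I : Set} (n : ℕ) (φ : LTL (Var I n)) → Satisfiable φ →
    NDC.Terminates φ ×
    NDC.Returns φ (λ clusters → IsPartition clusters × All (MinimalIndependent φ) clusters)
corollary2 n φ _ = terminates φ , λ s run →
  normalForm-returned φ (invariant φ run (mainLoop ([] , [] , []) (sym ∁⊥≡⊤)))
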